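{- The commutative monoid $\mathtt{Are}$ of cubical areas is a free commutative monoid and has infinitely many irreducible elements.
   Context: **Free commutative monoids.** Let $M$ be a commutative monoid. A unit of $M$ is an invertible element. A non-unit $x\in M$ is irreducible if, whenever $x=yz$ with $y,z\in M$, one of $y,z$ is a unit. Write $I(M)$ for the set of irreducible elements of $M$. For a set $X$, let $F(X)$ be the commutative monoid (under pointwise addition) of maps $\phi:X\to\mathbb{N}$ with $\{x\in X\mid \phi(x)\neq 0\}$ finite. $M$ is called free if the monoid morphism $F(I(M))\to M$, $\phi\mapsto\prod_{x\in I(M)}x^{\phi(x)}$, is an isomorphism; equivalently, every element of $M$ can be written as a product of irreducible elements in a unique way up to permutation of the factors (the empty product being the neutral element). **The homogeneous monoid.** Let $\mathbb{A}$ be any set (the alphabet), and let $\mathbb{A}^\ast$ be the set of finite words over $\mathbb{A}$, with concatenation $\ast$ and empty word $\epsilon$. For $S,S'\subseteq\mathbb{A}^\ast$ put $S\ast S'=\{w\ast w'\mid w\in S,\ w'\in S'\}$. A subset $H\subseteq\mathbb{A}^\ast$ is homogeneous if all its words have the same length $n$; this $n$ is the dimension $d(H)$ of $H$ (for $H$ nonempty). The symmetric group $\mathfrak{S}_n$ acts on words of length $n$ by $\sigma\cdot w=w\circ\sigma=(w_{\sigma(1)}\cdots w_{\sigma(n)})$, and on homogeneous sets of dimension $n$ by $\sigma\cdot H=\{\sigma\cdot w\mid w\in H\}$. Write $H\sim H'$ if $d(H)=d(H')=n$ and $H'=\sigma\cdot H$ for some $\sigma\in\mathfrak{S}_n$.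 The relation $\sim$ is a congruence for $\ast$. The homogeneous monoid $\mathcal{H}(\mathbb{A})$ is the set of $\sim$-classes of nonempty homogeneous subsets of $\mathbb{A}^\ast$ (the absorbing element $\emptyset$ being removed), with the product induced by $\ast$; it is a commutative monoid with neutral element the class of $\{\epsilon\}$. **Cubical areas.** Let $\mathcal{I}$ be the set of non-empty intervals of $\mathbb{R}$ (of any kind: open, closed, half-open, bounded or not, including single points). A cube of dimension $n$ is a word $C=I_1\cdots I_n$ of length $n$ over $\mathcal{I}$; it is identified with the subset $I_1\times\cdots\times I_n$ of $\mathbb{R}^n$, i.e. with a set of words of length $n$ over $\mathbb{R}$. Elements of $\mathcal{H}(\mathcal{I})$ are called cubical coverings. For a cubical covering $F$, let $\gamma(F)=\{\bigcup_{C\in S}C\mid S\in F\}\in\mathcal{H}(\mathbb{R})$, that is, the class of $\bigcup_{C\in S}C$ for any representative $S$ of $F$. A cubical area is an element $H\in\mathcal{H}(\mathbb{R})$ for which there is a finite cubical covering $F$ (i.e. a class in $\mathcal{H}(\mathcal{I})$ of finite sets of cubes) with $\gamma(F)=H$. The cubical areas form a submonoid $\mathtt{Are}$ of $\mathcal{H}(\mathbb{R})$. -}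

module Defs where

open import Algebra.Bundles using (CommutativeMonoid)
open import Algebra.Definitions using (Invertible)
open import Data.Empty using (⊥-elim)
open import Data.Fin.Base using (Fin; _↑ˡ_; _↑ʳ_; splitAt; join)
open import Data.Fin.Permutation as Perm
  using (Permutation; _⟨$⟩ʳ_; _⟨$⟩ˡ_; _∘ₚ_; inverseˡ; inverseʳ)
open import Data.Fin.Properties
  using (+↔⊎; splitAt-↑ˡ; splitAt-↑ʳ; join-splitAt)
open import Data.List.Base using (List; []; _∷_; foldr; cartesianProductWith)
open import Data.List.Relation.Unary.All using (All)
open import Data.List.Relation.Unary.Any using (here)
import Data.List.Membership.Setoid as Membership
import Data.List.Membership.Setoid.Properties as Membershipₚ
import Data.List.Relation.Binary.Permutation.Setoid as ListPerm
open import Data.Nat.Base using (ℕ; _+_)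
open import Data.Product.Base using (Σ; ∃-syntax; _×_; _,_; proj₁; proj₂)
open import Data.Rational.Base as ℚ using (ℚ)
open import Data.Sum.Base as Sum using (_⊎_; inj₁; inj₂; [_,_])
open import Data.Sum.Algebra using (⊎-assoc; ⊎-comm)
open import Data.Sum.Function.Propositional using (_⊎-↔_)
open import Data.Unit.Base using (⊤)
open import Data.Vec.Functional using (Vector; _++_)
import Data.Vec.Functional.Relation.Binary.Equality.Setoid as VecEq
open import Function.Base using (_∘_; _on_)
open import Function.Bundles
  using (_⇔_; _↔_; mk⇔; module Equivalence; module Inverse)
open import Function.Construct.Composition using (_↔-∘_)
open import Function.Construct.Identity using (↔-id)
open import Function.Construct.Symmetry using (↔-sym)
open import Function.Definitions using (Injective)
open import Level using (Lift; _⊔_; suc; 0ℓ)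
open import Relation.Binary.Bundles using (Setoid)
open import Relation.Binary.Definitions using (_Respects_)
open import Relation.Binary.PropositionalEquality.Core as ≡ using (_≡_)
open import Relation.Nullary.Negation using (¬_)
open import Relation.Unary using (Pred; _∈_; _⊆_; _≐_; Satisfiable)

module _ {c ℓ} (M : CommutativeMonoid c ℓ) where
  open CommutativeMonoid M

  IsUnit : Pred Carrier (c ⊔ ℓ)
  IsUnit = Invertible _≈_ ε _∙_

  Irreducible : Pred Carrier (c ⊔ ℓ)
  Irreducible x = ¬ IsUnit x × (∀ y z → x ≈ y ∙ z → IsUnit y ⊎ IsUnit z)

  product : List Carrier → Carrier
  product = foldr _∙_ ε

  -- Every element is a product of irreducibles in a unique way up to the order
  -- of the factors (and up to ≈ of corresponding factors).
  record IsFree : Set (c ⊔ ℓ) where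
    open ListPerm setoid using (_↭_)
    field
      factorization : ∀ x → ∃[ ps ] All Irreducible ps × x ≈ product ps
      uniqueness    : ∀ {ps qs} → All Irreducible ps → All Irreducible qs →
                      product ps ≈ product qs → ps ↭ qs

  InfinitelyManyIrreducibles : Set (c ⊔ ℓ)
  InfinitelyManyIrreducibles =
    ∃[ f ] (∀ (n : ℕ) → Irreducible (f n)) × Injective _≡_ _≈_ f

  submonoid : ∀ {p} (P : Pred Carrier p) → ε ∈ P →
              (∀ {x y} → x ∈ P → y ∈ P → x ∙ y ∈ P) →
              CommutativeMonoid (c ⊔ p) ℓ
  submonoid P ε∈P ∙-closed = record
    { Carrier = Σ Carrier P
    ; _≈_     = _≈_ on proj₁
    ; _∙_     = λ (x , x∈P) (y , y∈P) → x ∙ y , ∙-closed x∈P y∈P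
    ; ε       = ε , ε∈P
    ; isCommutativeMonoid = record
      { isMonoid = record
        { isSemigroup = record
          { isMagma = record
            { isEquivalence = record { refl = refl ; sym = sym ; trans = trans }
            ; ∙-cong        = ∙-cong
            }
          ; assoc = λ (x , _) (y , _) (z , _) → assoc x y z
          }
        ; identity = (λ (x , _) → identityˡ x) , (λ (x , _) → identityʳ x)
        }
      ; comm = λ (x , _) (y , _) → comm x y
      }
    }

module Words {a ℓ} (𝔸 : Setoid a ℓ) where
  open Setoid 𝔸 using (Carrier; reflexive)
  open VecEq 𝔸 public using (_≋_; ≋-refl; ≋-sym; ≋-trans; ≋-setoid; ++⁺)

  Word : ℕ → Set a
  Word = Vector Carrier

  -- Subsets live at the level needed for them to be closed under the
  -- operations below.
  WordSet : ℕ → Set (suc (a ⊔ ℓ))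
  WordSet n = Pred (Word n) (a ⊔ ℓ)

  infixr 7 _⊛_
  _⊛_ : ∀ {m n} → WordSet m → WordSet n → WordSet (m + n)
  (S ⊛ T) w = ∃[ u ] ∃[ v ] u ∈ S × v ∈ T × w ≋ u ++ v

  infixr 8 _·_
  _·_ : ∀ {m n} → Permutation m n → WordSet n → WordSet m
  (σ · S) w = ∃[ u ] u ∈ S × w ≋ u ∘ (σ ⟨$⟩ʳ_)

  private variable m n : ℕ

  ++-↑ˡ : (u : Word m) (v : Word n) → (u ++ v) ∘ (_↑ˡ n) ≋ u
  ++-↑ˡ {m} {n} u v i = reflexive (≡.cong [ u , v ] (splitAt-↑ˡ m i n))

  ++-↑ʳ : (u : Word m) (v : Word n) → (u ++ v) ∘ (m ↑ʳ_) ≋ v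
  ++-↑ʳ {m} {n} u v i = reflexive (≡.cong [ u , v ] (splitAt-↑ʳ m n i))

  ++-split : ∀ m {n} (w : Word (m + n)) → w ≋ (w ∘ (_↑ˡ n)) ++ (w ∘ (m ↑ʳ_))
  ++-split m {n} w i with splitAt m i | join-splitAt m n i
  ... | inj₁ _ | eq = reflexive (≡.cong w (≡.sym eq))
  ... | inj₂ _ | eq = reflexive (≡.cong w (≡.sym eq))

  module _ {S : WordSet m} {T : WordSet n} where

    ⊛⁺ : ∀ {w} → w ∘ (_↑ˡ n) ∈ S → w ∘ (m ↑ʳ_) ∈ T → w ∈ S ⊛ T
    ⊛⁺ {w} wˡ wʳ = _ , _ , wˡ , wʳ , ++-split m w

    ⊛⁻ˡ : S Respects _≋_ → ∀ {w} → w ∈ S ⊛ T → w ∘ (_↑ˡ n) ∈ S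
    ⊛⁻ˡ resp (u , v , u∈S , _ , eq) =
      resp (≋-sym (≋-trans (eq ∘ (_↑ˡ n)) (++-↑ˡ u v))) u∈S

    ⊛⁻ʳ : T Respects _≋_ → ∀ {w} → w ∈ S ⊛ T → w ∘ (m ↑ʳ_) ∈ T
    ⊛⁻ʳ resp (u , v , _ , v∈T , eq) =
      resp (≋-sym (≋-trans (eq ∘ (m ↑ʳ_)) (++-↑ʳ u v))) v∈T

  record Homogeneous : Set (suc (a ⊔ ℓ)) where
    field
      dim      : ℕ
      words    : WordSet dim
      resp     : words Respects _≋_
      nonempty : Satisfiable words

  open Homogeneous

  -- A permutation between Fin m and Fin n forces m ≡ n, so equality of the
  -- dimensions is part of this relation.
  infix 4 _∼_
  _∼_ : Homogeneous → Homogeneous → Set (a ⊔ ℓ)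
  H ∼ K = Σ (Permutation (dim K) (dim H)) λ σ → words K ≐ σ · words H

  mk∼ : ∀ H K (σ : Permutation (dim K) (dim H)) →
        (∀ {w} → w ∈ words H → w ∘ (σ ⟨$⟩ʳ_) ∈ words K) →
        (∀ {w} → w ∈ words K → w ∘ (σ ⟨$⟩ˡ_) ∈ words H) →
        H ∼ K
  mk∼ H K σ to from =
    σ
    , (λ {w} w∈K → _ , from w∈K ,
         λ i → reflexive (≡.cong w (≡.sym (inverseˡ σ))))
    , (λ (u , u∈H , eq) → resp K (≋-sym eq) (to u∈H))

  ∼-to : ∀ {H K} ((σ , _) : H ∼ K) →
         ∀ {w} → w ∈ words H → w ∘ (σ ⟨$⟩ʳ_) ∈ words K
  ∼-to (σ , _ , ⊆K) w∈H = ⊆K (_ , w∈H , ≋-refl)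

  ∼-from : ∀ {H K} ((σ , _) : H ∼ K) →
           ∀ {w} → w ∈ words K → w ∘ (σ ⟨$⟩ˡ_) ∈ words H
  ∼-from {H} (σ , K⊆ , _) w∈K with K⊆ w∈K
  ... | u , u∈H , eq = resp H
    (≋-sym (≋-trans (eq ∘ (σ ⟨$⟩ˡ_))
                    (λ i → reflexive (≡.cong u (inverseʳ σ)))))
    u∈H

  ∼-refl : ∀ {H} → H ∼ H
  ∼-refl {H} = mk∼ H H Perm.id (λ h → h) (λ h → h)

  ∼-sym : ∀ {H K} → H ∼ K → K ∼ H
  ∼-sym {H} {K} e@(σ , _) =
    mk∼ K H (Perm.flip σ) (∼-from {H} {K} e) (∼-to {H} {K} e)

  ∼-trans : ∀ {H K L} → H ∼ K → K ∼ L → H ∼ L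
  ∼-trans {H} {K} {L} e@(σ , _) f@(τ , _) = mk∼ H L (τ ∘ₚ σ)
    (∼-to {K} {L} f ∘ ∼-to {H} {K} e)
    (∼-from {H} {K} e ∘ ∼-from {K} {L} f)

  infixr 7 _⋆_
  _⋆_ : Homogeneous → Homogeneous → Homogeneous
  H ⋆ K = record
    { dim      = dim H + dim K
    ; words    = words H ⊛ words K
    ; resp     = λ { w≋w′ (u , v , u∈H , v∈K , eq) →
                     u , v , u∈H , v∈K , ≋-trans (≋-sym w≋w′) eq }
    ; nonempty = let u , u∈H = nonempty H ; v , v∈K = nonempty K
                 in u ++ v , u , v , u∈H , v∈K , ≋-refl
    }

  -- The empty word is the only word of length 0.
  unit : Homogeneous
  unit = record
    { dim      = 0
    ; words    = λ w → Lift (a ⊔ ℓ) ⊤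
    ; resp     = λ _ _ → _
    ; nonempty = (λ ()) , _
    }

  reindex : ∀ H {n} {f g : Fin (dim H) → Fin n} (w : Word n) →
            (∀ i → f i ≡ g i) → w ∘ f ∈ words H → w ∘ g ∈ words H
  reindex H w f≗g = resp H λ i → reflexive (≡.cong w (f≗g i))

  blocks : ∀ {m n m′ n′} → (Fin m ⊎ Fin n) ↔ (Fin m′ ⊎ Fin n′) →
           Permutation (m + n) (m′ + n′)
  blocks β = ↔-sym +↔⊎ ↔-∘ (β ↔-∘ +↔⊎)

  module _ {m n} {B : Set} (f : Fin m ⊎ Fin n → B) where
    at-↑ˡ : ∀ i → f (inj₁ i) ≡ f (splitAt m (i ↑ˡ n))
    at-↑ˡ i = ≡.cong f (≡.sym (splitAt-↑ˡ m i n))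

    at-↑ʳ : ∀ i → f (inj₂ i) ≡ f (splitAt m (m ↑ʳ i))
    at-↑ʳ i = ≡.cong f (≡.sym (splitAt-↑ʳ m n i))

  assoc↔ : ∀ m n p → (Fin m ⊎ Fin (n + p)) ↔ (Fin (m + n) ⊎ Fin p)
  assoc↔ m n p =
    (↔-sym +↔⊎ ⊎-↔ ↔-id (Fin p)) ↔-∘
    (↔-sym (⊎-assoc 0ℓ (Fin m) (Fin n) (Fin p)) ↔-∘
    (↔-id (Fin m) ⊎-↔ +↔⊎))

  ⋆-cong : ∀ {H H′ K K′} → H ∼ H′ → K ∼ K′ → H ⋆ K ∼ H′ ⋆ K′
  ⋆-cong {H} {H′} {K} {K′} e@(σ , _) f@(τ , _) =
    mk∼ (H ⋆ K) (H′ ⋆ K′) (blocks (σ ⊎-↔ τ))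
      (λ {w} h → ⊛⁺
        (reindex H′ w (at-↑ˡ to) (∼-to {H} {H′} e (⊛⁻ˡ (resp H) h)))
        (reindex K′ w (at-↑ʳ to) (∼-to {K} {K′} f (⊛⁻ʳ (resp K) h))))
      (λ {w} h → ⊛⁺
        (reindex H w (at-↑ˡ from) (∼-from {H} {H′} e (⊛⁻ˡ (resp H′) h)))
        (reindex K w (at-↑ʳ from) (∼-from {K} {K′} f (⊛⁻ʳ (resp K′) h))))
    where
    to   = join (dim H) (dim K) ∘ Inverse.to (σ ⊎-↔ τ)
    from = join (dim H′) (dim K′) ∘ Inverse.from (σ ⊎-↔ τ)

  ⋆-comm : ∀ H K → H ⋆ K ∼ K ⋆ H
  ⋆-comm H K = mk∼ (H ⋆ K) (K ⋆ H) (blocks (⊎-comm (Fin (dim K)) (Fin (dim H))))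
    (λ {w} h → ⊛⁺
      (reindex K w (at-↑ˡ to) (⊛⁻ʳ (resp K) h))
      (reindex H w (at-↑ʳ to) (⊛⁻ˡ (resp H) h)))
    (λ {w} h → ⊛⁺
      (reindex H w (at-↑ˡ from) (⊛⁻ʳ (resp H) h))
      (reindex K w (at-↑ʳ from) (⊛⁻ˡ (resp K) h)))
    where
    to   = join (dim H) (dim K) ∘ Sum.swap
    from = join (dim K) (dim H) ∘ Sum.swap

  ⋆-assoc : ∀ H K L → (H ⋆ K) ⋆ L ∼ H ⋆ (K ⋆ L)
  ⋆-assoc H K L =
    mk∼ ((H ⋆ K) ⋆ L) (H ⋆ (K ⋆ L)) (blocks β)
      (λ {w} x → let hk = ⊛⁻ˡ (resp (H ⋆ K)) x in ⊛⁺
        (reindex H w (at-↑ˡ to) (⊛⁻ˡ (resp H) hk))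
        (⊛⁺
          (reindex K w (λ j → ≡.trans (at-↑ˡ toʳ j) (at-↑ʳ to (j ↑ˡ l)))
            (⊛⁻ʳ (resp K) hk))
          (reindex L w (λ i → ≡.trans (at-↑ʳ toʳ i) (at-↑ʳ to (k ↑ʳ i)))
            (⊛⁻ʳ (resp L) x))))
      (λ {w} x → let kl = ⊛⁻ʳ (resp (K ⋆ L)) x in ⊛⁺
        (⊛⁺
          (reindex H w (λ i → ≡.trans (at-↑ˡ fromˡ i) (at-↑ˡ from (i ↑ˡ k)))
            (⊛⁻ˡ (resp H) x))
          (reindex K w (λ j → ≡.trans (at-↑ʳ fromˡ j) (at-↑ˡ from (h ↑ʳ j)))
            (⊛⁻ˡ (resp K) kl)))
        (reindex L w (at-↑ʳ from) (⊛⁻ʳ (resp L) kl)))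
    where
    h = dim H
    k = dim K
    l = dim L
    β     = assoc↔ h k l
    to    = join (h + k) l ∘ Inverse.to β
    from  = join h (k + l) ∘ Inverse.from β
    toʳ   = λ (s : Fin k ⊎ Fin l) →
      join (h + k) l (Sum.map₁ (join h k) (Sum.assocˡ (inj₂ s)))
    fromˡ = λ (s : Fin h ⊎ Fin k) →
      join h (k + l) (Sum.map₂ (join k l) (Sum.assocʳ (inj₁ s)))

  ⋆-identityˡ : ∀ H → unit ⋆ H ∼ H
  ⋆-identityˡ H = mk∼ (unit ⋆ H) H Perm.id
    (⊛⁻ʳ (resp H)) (⊛⁺ {S = words unit} _)

  homogeneousMonoid : CommutativeMonoid (suc (a ⊔ ℓ)) (a ⊔ ℓ)
  homogeneousMonoid = record
    { Carrier = Homogeneous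
    ; _≈_     = _∼_
    ; _∙_     = _⋆_
    ; ε       = unit
    ; isCommutativeMonoid = record
      { isMonoid = record
        { isSemigroup = record
          { isMagma = record
            { isEquivalence = record
              { refl  = λ {H} → ∼-refl {H}
              ; sym   = λ {H K} → ∼-sym {H} {K}
              ; trans = λ {H K L} → ∼-trans {H} {K} {L}
              }
            ; ∙-cong = λ {H H′ K K′} → ⋆-cong {H} {H′} {K} {K′}
            }
          ; assoc = ⋆-assoc
          }
        ; identity = ⋆-identityˡ , λ H →
            ∼-trans {H ⋆ unit} {unit ⋆ H} {H} (⋆-comm H unit) (⋆-identityˡ H)
        }
      ; comm = ⋆-comm
      }
    }

  FinitelyMany : Pred Homogeneous (a ⊔ ℓ)
  FinitelyMany H = ∃[ ws ] (∀ w → w ∈ words H ⇔ w ∈ₗ ws)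
    where open Membership (≋-setoid (dim H)) renaming (_∈_ to _∈ₗ_)

-- Two-sided Dedekind cuts of ℚ. Only the order of the reals is needed, so no
-- field operations are defined.
record ℝ : Set₁ where
  field
    L U       : Pred ℚ 0ℓ
    L-inhab   : Satisfiable L
    U-inhab   : Satisfiable U
    L-rounded : ∀ q → q ∈ L ⇔ (∃[ r ] q ℚ.< r × r ∈ L)
    U-rounded : ∀ q → q ∈ U ⇔ (∃[ r ] r ℚ.< q × r ∈ U)
    disjoint  : ∀ q → ¬ (q ∈ L × q ∈ U)
    located   : ∀ q r → q ℚ.< r → q ∈ L ⊎ r ∈ U

open ℝ

module Real where
  infix 4 _≤_ _<_ _≈_

  _≤_ : ℝ → ℝ → Set
  x ≤ y = L x ⊆ L y

  _<_ : ℝ → ℝ → Set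
  x < y = ∃[ q ] q ∈ U x × q ∈ L y

  _≈_ : ℝ → ℝ → Set
  x ≈ y = x ≤ y × y ≤ x

  -- The lower cut determines the upper one, so comparing lower cuts suffices.
  U-antitone : ∀ {x y} → x ≤ y → U y ⊆ U x
  U-antitone {x} {y} x≤y {q} q∈U
    with r , r<q , r∈U ← Equivalence.to (U-rounded y q) q∈U
    with located x r q r<q
  ... | inj₁ r∈L = ⊥-elim (disjoint y r (x≤y r∈L , r∈U))
  ... | inj₂ q∈U = q∈U

  <-≤-trans : ∀ {x y z} → x < y → y ≤ z → x < z
  <-≤-trans (q , q∈Ux , q∈Ly) y≤z = q , q∈Ux , y≤z q∈Ly

  ≤-<-trans : ∀ {x y z} → x ≤ y → y < z → x < z
  ≤-<-trans {x} {y} x≤y (q , q∈Uy , q∈Lz) =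
    q , U-antitone {x} {y} x≤y q∈Uy , q∈Lz

  setoid : Setoid (suc 0ℓ) 0ℓ
  setoid = record
    { Carrier = ℝ
    ; _≈_     = _≈_
    ; isEquivalence = record
      { refl  = (λ q → q) , (λ q → q)
      ; sym   = λ (p , q) → q , p
      ; trans = λ (p , q) (p′ , q′) → (λ i → p′ (p i)) , (λ i → q (q′ i))
      }
    }

data Endpoint : Set₁ where
  unbounded           : Endpoint
  excluding including : ℝ → Endpoint

_isAbove_ : ℝ → Endpoint → Set
x isAbove unbounded   = ⊤
x isAbove excluding a = a Real.< x
x isAbove including a = a Real.≤ x

_isBelow_ : ℝ → Endpoint → Set
x isBelow unbounded   = ⊤
x isBelow excluding b = x Real.< b
x isBelow including b = x Real.≤ b

record Interval : Set₁ where
  field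
    lower upper : Endpoint

  contains : Pred ℝ 0ℓ
  contains x = x isAbove lower × x isBelow upper

  field
    nonempty : Satisfiable contains

open Interval using (contains)

contains-resp : ∀ I → contains I Respects Real._≈_
contains-resp I {x} {y} (x≤y , y≤x) (above , below) =
  above′ (Interval.lower I) above , below′ (Interval.upper I) below
  where
  above′ : ∀ e → x isAbove e → y isAbove e
  above′ unbounded     _   = _
  above′ (excluding a) a<x = Real.<-≤-trans {a} {x} {y} a<x x≤y
  above′ (including a) a≤x = x≤y ∘ a≤x

  below′ : ∀ e → x isBelow e → y isBelow e
  below′ unbounded     _   = _
  below′ (excluding b) x<b = Real.≤-<-trans {y} {x} {b} y≤x x<b
  below′ (including b) x≤b = x≤b ∘ y≤x

-- Intervals are subsets of ℝ, hence compared extensionally.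
intervalSetoid : Setoid (suc 0ℓ) (suc 0ℓ)
intervalSetoid = record
  { Carrier = Interval
  ; _≈_     = λ I J → contains I ≐ contains J
  ; isEquivalence = record
    { refl  = (λ x → x) , (λ x → x)
    ; sym   = λ (p , q) → q , p
    ; trans = λ (p , q) (p′ , q′) → (λ i → p′ (p i)) , (λ i → q (q′ i))
    }
  }

module Wℝ = Words Real.setoid
module W𝓘 = Words intervalSetoid

Cube : ℕ → Set₁
Cube = W𝓘.Word

⟦_⟧ : ∀ {n} → Cube n → Pred (Wℝ.Word n) 0ℓ
⟦ C ⟧ x = ∀ i → x i ∈ contains (C i)

CubicalCovering : Set₂
CubicalCovering = W𝓘.Homogeneous

γ : CubicalCovering → Wℝ.Homogeneous
γ F = record
  { dim      = F.dim
  ; words    = λ x → ∃[ C ] C ∈ F.words × x ∈ ⟦ C ⟧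
  ; resp     = λ x≋y (C , C∈F , x∈C) →
                 C , C∈F , λ i → contains-resp (C i) (x≋y i) (x∈C i)
  ; nonempty = let C , C∈F = F.nonempty in
                 (λ i → proj₁ (Interval.nonempty (C i))) ,
                 C , C∈F , λ i → proj₂ (Interval.nonempty (C i))
  }
  where module F = W𝓘.Homogeneous F

-- γ depends only on the class of the covering.
γ-cong : ∀ {F G} → F W𝓘.∼ G → γ F Wℝ.∼ γ G
γ-cong {F} {G} e@(σ , _) = Wℝ.mk∼ (γ F) (γ G) σ
  (λ (C , C∈F , x∈C) → _ , W𝓘.∼-to {F} {G} e C∈F , λ i → x∈C (σ ⟨$⟩ʳ i))
  (λ (C , C∈G , x∈C) → _ , W𝓘.∼-from {F} {G} e C∈G , λ i → x∈C (σ ⟨$⟩ˡ i))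

IsCubicalArea : Pred Wℝ.Homogeneous (suc (suc 0ℓ))
IsCubicalArea H =
  Σ CubicalCovering λ F → W𝓘.FinitelyMany F × γ F Wℝ.∼ H

γ-unit : γ W𝓘.unit Wℝ.∼ Wℝ.unit
γ-unit = Wℝ.mk∼ (γ W𝓘.unit) Wℝ.unit Perm.id _ (λ _ → (λ ()) , _ , λ ())

γ-⋆ : ∀ F G → γ (F W𝓘.⋆ G) Wℝ.∼ γ F Wℝ.⋆ γ G
γ-⋆ F G = Wℝ.mk∼ (γ (F W𝓘.⋆ G)) (γ F Wℝ.⋆ γ G) Perm.id
  (λ {x} (C , C∈ , x∈C) → Wℝ.⊛⁺ {S = words (γ F)} {words (γ G)} {x}
    (_ , W𝓘.⊛⁻ˡ {S = F.words} {G.words} F.resp {C} C∈ , x∈C ∘ (_↑ˡ G.dim))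
    (_ , W𝓘.⊛⁻ʳ {S = F.words} {G.words} G.resp {C} C∈ , x∈C ∘ (F.dim ↑ʳ_)))
  (λ {x} (u , v , (C , C∈F , u∈C) , (D , D∈G , v∈D) , x≋uv) →
    C ++ D , (C , D , C∈F , D∈G , W𝓘.≋-refl {x = C ++ D}) ,
    λ i → contains-resp ((C ++ D) i) {(u ++ v) i} {x i}
            (Setoid.sym Real.setoid {x i} {(u ++ v) i} (x≋uv i))
            (glue {u = u} {v} {C} {D} u∈C v∈D i))
  where
  module F = W𝓘.Homogeneous F
  module G = W𝓘.Homogeneous G
  open Wℝ.Homogeneous
  glue : ∀ {m n} {u : Wℝ.Word m} {v : Wℝ.Word n} {C D} →
         u ∈ ⟦ C ⟧ → v ∈ ⟦ D ⟧ → (u ++ v) ∈ ⟦ C ++ D ⟧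
  glue {m} u∈C v∈D i with splitAt m i
  ... | inj₁ j = u∈C j
  ... | inj₂ j = v∈D j

finite-unit : W𝓘.FinitelyMany W𝓘.unit
finite-unit = (λ ()) ∷ [] , λ w → mk⇔ (λ _ → here λ ()) _

finite-⋆ : ∀ F G → W𝓘.FinitelyMany F → W𝓘.FinitelyMany G →
           W𝓘.FinitelyMany (F W𝓘.⋆ G)
finite-⋆ F G (Cs , F⇔) (Ds , G⇔) =
  cartesianProductWith _++_ Cs Ds , λ w → mk⇔
    (λ (C , D , C∈F , D∈G , eq) →
      Membershipₚ.∈-resp-≈ (S (m + n)) {x = C ++ D} {w}
        (Setoid.sym (S (m + n)) {w} {C ++ D} eq)
        (Membershipₚ.∈-cartesianProductWith⁺ (S m) (S n) (S (m + n))
          (λ {C} {C′} {D} {D′} →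
            W𝓘.++⁺ (Setoid._≈_ intervalSetoid) {xs = C} {C′} {D} {D′})
          (Equivalence.to (F⇔ C) C∈F) (Equivalence.to (G⇔ D) D∈G)))
    (λ w∈ →
      let C , D , C∈ , D∈ , eq =
            Membershipₚ.∈-cartesianProductWith⁻ (S m) (S n) (S (m + n))
              _++_ Cs Ds {w} w∈
      in C , D , Equivalence.from (F⇔ C) C∈ , Equivalence.from (G⇔ D) D∈ , eq)
  where
  S = W𝓘.≋-setoid
  m = W𝓘.Homogeneous.dim F
  n = W𝓘.Homogeneous.dim G

Are : CommutativeMonoid (suc (suc 0ℓ)) (suc 0ℓ)
Are = submonoid Wℝ.homogeneousMonoid IsCubicalArea
  (W𝓘.unit , finite-unit , γ-unit)
  λ {H} {K} (F , F-fin , γF∼H) (G , G-fin , γG∼K) →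
    F W𝓘.⋆ G , finite-⋆ F G F-fin G-fin ,
    Wℝ.∼-trans {γ (F W𝓘.⋆ G)} {γ F Wℝ.⋆ γ G} {H Wℝ.⋆ K} (γ-⋆ F G)
      (Wℝ.⋆-cong {γ F} {H} {γ G} {K} γF∼H γG∼K)

{-# OPTIONS --safe #-}

-- A commutative monoid with an additive size vanishing only at ε is atomic, and
-- if it has Riesz refinement (a ∙ b ≈ c ∙ d splits into a two-by-two table of
-- factors) then its irreducibles are prime and cancel against each other, so it
-- is free. For homogeneous sets the size is the dimension. Refinement holds
-- because H is a product along a partition of its coordinates exactly when the
-- two groups of coordinates vary independently, and this passes to the
-- restriction of H to any subset of the coordinates: two product
-- decompositions of H restrict to each other's factors. Restricting a finite
-- union of cubes gives a finite union of cubes, so a factor of a cubical area is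
-- a cubical area and refinement is inherited by Are. The singletons {n} ⊆ ℝ have
-- dimension 1, hence are irreducible.

module Submission where

open import Algebra.Bundles using (CommutativeMonoid)
open import Axiom.ExcludedMiddle using (ExcludedMiddle)
open import Data.Empty using (⊥-elim)
open import Data.Fin.Base using (Fin; zero; suc; _↑ˡ_; _↑ʳ_; splitAt; join)
open import Data.Fin.Permutation as Perm
  using (Permutation; _⟨$⟩ʳ_; _⟨$⟩ˡ_; inverseˡ; inverseʳ)
open import Data.Fin.Properties
  using (any?; _≟_; ¬Fin0; splitAt-↑ˡ; splitAt-↑ʳ; join-splitAt;
         ↑ˡ-injective; ↑ʳ-injective)
import Data.Integer.Base as ℤ
open import Data.List.Base as List
  using (List; []; _∷_; allFin; filter; length; lookup; map)
import Data.List.Membership.Setoid.Properties as Membershipₚ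
open import Data.List.Membership.Propositional.Properties
  using (∈-filter⁺; ∈-filter⁻; ∈-allFin; ∈-lookup)
import Data.List.Relation.Binary.Permutation.Setoid as ListPerm
open import Data.List.Relation.Unary.All as All using (All; []; _∷_)
import Data.List.Relation.Unary.All.Properties as All
open import Data.List.Relation.Unary.AllPairs using (_∷_)
open import Data.List.Relation.Unary.Any using (here; there; index)
open import Data.List.Relation.Unary.Any.Properties using (lookup-index)
open import Data.List.Relation.Unary.Unique.Propositional using (Unique)
import Data.List.Relation.Unary.Unique.Propositional.Properties as Unique
open import Data.Nat.Base using (ℕ; suc; _+_; _<_; z≤n; s≤s)
import Data.Nat.Coprimality as Coprime
open import Data.Nat.Induction using (<-wellFounded; Acc; acc)
import Data.Nat.Properties as ℕ
open import Data.Product.Base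
  using (Σ-syntax; ∃-syntax; _×_; _,_; proj₁; proj₂)
open import Data.Rational.Base as ℚ using (ℚ; mkℚ)
import Data.Rational.Properties as ℚ
open import Data.Sum.Base as Sum using (_⊎_; inj₁; inj₂; [_,_])
open import Data.Vec.Functional using (_++_)
open import Function.Base using (_∘_; id)
open import Function.Bundles using (mk⇔; module Equivalence)
open import Function.Definitions using (Injective)
open import Level using (0ℓ; _⊔_)
open import Relation.Binary.Bundles using (Setoid)
open import Relation.Binary.Definitions using (tri<; tri≈; tri>)
open import Relation.Binary.PropositionalEquality.Core as ≡
  using (_≡_; _≢_; refl; cong)
open import Relation.Nullary using (¬_; yes; no)
open import Relation.Nullary.Decidable using (_×-dec_)
open import Relation.Unary using (Pred; Decidable; _∈_; _⊆_; _≐_; _∩_)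
open import Defs

-- Freeness of commutative monoids with size and refinement.

module _ {c ℓ} (M : CommutativeMonoid c ℓ) where
  open CommutativeMonoid M hiding (refl)

  Refinement : Set _
  Refinement = ∀ {a b c d} → a ∙ b ≈ c ∙ d →
    ∃[ r ] ∃[ s ] ∃[ t ] ∃[ u ]
      a ≈ r ∙ s × b ≈ t ∙ u × c ≈ r ∙ t × d ≈ s ∙ u

  record Size : Set (c ⊔ ℓ) where
    field
      size       : Carrier → ℕ
      size-cong  : ∀ {x y} → x ≈ y → size x ≡ size y
      size-∙     : ∀ x y → size (x ∙ y) ≡ size x + size y
      size≡0⇒≈ε  : ∀ {x} → size x ≡ 0 → x ≈ ε

module _ {c ℓ} (M : CommutativeMonoid c ℓ) (sz : Size M) where
  open CommutativeMonoid M hiding (refl)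
  open ListPerm setoid using (_↭_; ↭-refl; ↭-prep; ↭-swap; ↭-trans; ↭-sym)
  open Size sz

  size-ε : size ε ≡ 0
  size-ε = ≡.sym (ℕ.+-cancelˡ-≡ (size ε) 0 (size ε)
    (≡.trans (ℕ.+-identityʳ (size ε))
      (≡.trans (size-cong (sym (identityˡ ε))) (size-∙ ε ε))))

  unit⇒≈ε : ∀ {x} → IsUnit M x → x ≈ ε
  unit⇒≈ε {x} (y , _ , x∙y≈ε) = size≡0⇒≈ε (ℕ.m+n≡0⇒m≡0 (size x)
    (≡.trans (≡.sym (size-∙ x y)) (≡.trans (size-cong x∙y≈ε) size-ε)))

  size≡0⇒unit : ∀ {x} → size x ≡ 0 → IsUnit M x
  size≡0⇒unit {x} eq = ε , trans (identityˡ x) x≈ε , trans (identityʳ x) x≈ε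
    where x≈ε = size≡0⇒≈ε eq

  -- In any splitting the two sizes add up to 1, so one of them is 0 and that factor is a unit.
  size≡1⇒irreducible : ∀ {x} → size x ≡ 1 → Irreducible M x
  size≡1⇒irreducible {x} eq = nonunit , splits
    where
    nonunit : ¬ IsUnit M x
    nonunit x-unit
      with () ← ≡.trans (≡.sym eq) (≡.trans (size-cong (unit⇒≈ε x-unit)) size-ε)
    splits : ∀ y z → x ≈ y ∙ z → IsUnit M y ⊎ IsUnit M z
    splits y z x≈yz
      with size y in y≡ | size z in z≡
         | ≡.trans (≡.sym eq) (≡.trans (size-cong x≈yz) (size-∙ y z))
    ... | 0           | _     | _  = inj₁ (size≡0⇒unit y≡)
    ... | 1           | 0     | _  = inj₂ (size≡0⇒unit z≡)
    ... | 1           | suc _ | ()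
    ... | suc (suc _) | _     | ()

  product-++ : ∀ xs ys → product M (xs List.++ ys) ≈ product M xs ∙ product M ys
  product-++ []       ys = sym (identityˡ _)
  product-++ (x ∷ xs) ys =
    trans (∙-congˡ (product-++ xs ys)) (sym (assoc x _ _))

  module _ (em : ∀ {ℓ} → ExcludedMiddle ℓ) where

    -- Well-founded recursion on size: when both factors are non-units, both sizes are nonzero, so
    -- each factor is strictly smaller than `x`. A unit gets the empty product.
    factorize : ∀ x → Acc _<_ (size x) →
                ∃[ ps ] All (Irreducible M) ps × x ≈ product M ps
    factorize x (acc rec) with em {P = IsUnit M x}
    ... | yes x-unit = [] , [] , unit⇒≈ε x-unit
    ... | no x-nonunit
      with em {P = ∃[ y ] ∃[ z ] x ≈ y ∙ z × ¬ IsUnit M y × ¬ IsUnit M z}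
    ... | no indecomposable =
      x ∷ [] , (x-nonunit , splits) ∷ [] , sym (identityʳ x)
      where
      splits : ∀ y z → x ≈ y ∙ z → IsUnit M y ⊎ IsUnit M z
      splits y z x≈yz with em {P = IsUnit M y} | em {P = IsUnit M z}
      ... | yes y-unit | _          = inj₁ y-unit
      ... | no _       | yes z-unit = inj₂ z-unit
      ... | no ¬y      | no ¬z      =
        ⊥-elim (indecomposable (y , z , x≈yz , ¬y , ¬z))
    ... | yes (y , z , x≈yz , ¬y , ¬z) =
      let size-x = ≡.trans (size-cong x≈yz) (size-∙ y z)
          y<x = ≡.subst (size y <_) (≡.sym size-x)
                  (ℕ.m<m+n (size y) (ℕ.n≢0⇒n>0 (¬z ∘ size≡0⇒unit)))
          z<x = ≡.subst (size z <_) (≡.sym size-x)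
                  (ℕ.m<n+m (size z) (ℕ.n≢0⇒n>0 (¬y ∘ size≡0⇒unit)))
          ps , ps-irr , y≈ = factorize y (rec y<x)
          qs , qs-irr , z≈ = factorize z (rec z<x)
      in ps List.++ qs , All.++⁺ ps-irr qs-irr ,
         trans x≈yz (trans (∙-cong y≈ z≈) (sym (product-++ ps qs)))

    module _ (refine : Refinement M) where

      ε≈product⇒≡[] : ∀ {qs} → All (Irreducible M) qs → ε ≈ product M qs →
                      qs ≡ []
      ε≈product⇒≡[] [] _ = ≡.refl
      ε≈product⇒≡[] {q ∷ qs} ((q-nonunit , _) ∷ _) ε≈ =
        ⊥-elim (q-nonunit (product M qs , trans (comm _ q) (sym ε≈) , sym ε≈))

      -- Primality of `p` and cancellation of `p` in one induction on `qs`. Refining `p ∙ x` against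
      -- `q ∙ Q` splits `p` into a part `r` of `q` and a part `s` of the tail `Q`; irreducibility
      -- makes one of them a unit.
      extract : ∀ {p x qs} → Irreducible M p → All (Irreducible M) qs →
                p ∙ x ≈ product M qs →
                ∃[ qs′ ] qs ↭ p ∷ qs′ × All (Irreducible M) qs′ ×
                         x ≈ product M qs′
      extract {p} {x} (p-nonunit , _) [] px≈ε =
        ⊥-elim (p-nonunit (x , trans (comm x p) px≈ε , px≈ε))
      extract {p} {x} {q ∷ qs} p-irr@(p-nonunit , p-splits)
              (q-irr@(_ , q-splits) ∷ qs-irr) px≈
        with r , s , t , u , p≈rs , x≈tu , q≈rt , Q≈su ← refine px≈
        with p-splits r s p≈rs
      -- Here `p` lies entirely in the tail, which is `p ∙ u`, so the recursion finds it there; `q`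
      -- is kept as the factor `t` of `x`.
      ... | inj₁ r-unit =
        let r≈ε = unit⇒≈ε r-unit
            p≈s = trans p≈rs (trans (∙-congʳ r≈ε) (identityˡ s))
            q≈t = trans q≈rt (trans (∙-congʳ r≈ε) (identityˡ t))
            qs′ , qs↭ , qs′-irr , u≈ =
              extract p-irr qs-irr (trans (∙-congʳ p≈s) (sym Q≈su))
        in q ∷ qs′ , ↭-trans (↭-prep q qs↭) (↭-swap q p ↭-refl) ,
           q-irr ∷ qs′-irr , trans x≈tu (∙-cong (sym q≈t) u≈)
      -- Here `p` divides the head `q`.
      ... | inj₂ s-unit =
        qs , ListPerm.prep q≈p ↭-refl , qs-irr , x≈Q
        where
        s≈ε = unit⇒≈ε s-unit
        p≈r = trans p≈rs (trans (∙-congˡ s≈ε) (identityʳ r))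
        Q≈u = trans Q≈su (trans (∙-congʳ s≈ε) (identityˡ u))
        t≈ε : t ≈ ε
        -- Irreducibility of `q` now acts on `q ≈ p ∙ t`: since `p` is a non-unit, the cofactor `t`
        -- is trivial and `q ≈ p`.
        t≈ε with q-splits p t (trans q≈rt (∙-congʳ (sym p≈r)))
        ... | inj₁ p-unit = ⊥-elim (p-nonunit p-unit)
        ... | inj₂ t-unit = unit⇒≈ε t-unit
        q≈p = trans q≈rt (trans (∙-cong (sym p≈r) t≈ε) (identityʳ p))
        x≈Q = trans x≈tu (trans (∙-cong t≈ε (sym Q≈u)) (identityˡ _))

      unique : ∀ {ps qs} → All (Irreducible M) ps → All (Irreducible M) qs →
               product M ps ≈ product M qs → ps ↭ qs
      unique [] qs-irr ε≈
        rewrite ε≈product⇒≡[] qs-irr ε≈ = ↭-refl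
      unique {p ∷ ps} (p-irr ∷ ps-irr) qs-irr eq =
        let qs′ , qs↭ , qs′-irr , ps≈ = extract p-irr qs-irr eq
        in ↭-trans (↭-prep p (unique ps-irr qs′-irr ps≈)) (↭-sym qs↭)

      isFree : IsFree M
      isFree = record
        { factorization = λ x → factorize x (<-wellFounded (size x))
        ; uniqueness    = unique
        }

-- Finite sets of coordinates, presented as injections.

private variable k l m n : ℕ

Image : (Fin k → Fin n) → Pred (Fin n) 0ℓ
Image f i = ∃[ j ] f j ≡ i

image? : (f : Fin k → Fin n) → Decidable (Image f)
image? f i = any? λ j → f j ≟ i

-- The permutation sends `i` to the `g`-preimage of `f i`; injectivity makes the two choices of
-- preimages mutually inverse.
sameImage⇒↔ : {f : Fin k → Fin n} {g : Fin l → Fin n} →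
              Injective _≡_ _≡_ f → Injective _≡_ _≡_ g →
              (∀ i → Image g (f i)) → (∀ j → Image f (g j)) →
              ∃[ π ] ∀ i → g (π ⟨$⟩ʳ i) ≡ f i
sameImage⇒↔ f-inj g-inj to from =
  Perm.permutation (proj₁ ∘ to) (proj₁ ∘ from)
    (λ j → g-inj (≡.trans (proj₂ (to _)) (proj₂ (from j))))
    (λ i → f-inj (≡.trans (proj₂ (from _)) (proj₂ (to i))))
  , proj₂ ∘ to

lookup-injective : ∀ {a} {A : Set a} {xs : List A} → Unique xs →
                   Injective _≡_ _≡_ (lookup xs)
lookup-injective (_ ∷ _)      {zero}  {zero}  _  = refl
lookup-injective (x∉xs ∷ _)   {zero}  {suc j} eq =
  ⊥-elim (All.lookup x∉xs (∈-lookup j) eq)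
lookup-injective (x∉xs ∷ _)   {suc i} {zero}  eq =
  ⊥-elim (All.lookup x∉xs (∈-lookup i) (≡.sym eq))
lookup-injective (_ ∷ xs-unq) {suc i} {suc j} eq =
  cong suc (lookup-injective xs-unq eq)

enumerate : {P : Pred (Fin n) 0ℓ} → Decidable P →
            ∃[ k ] Σ[ e ∈ (Fin k → Fin n) ] Injective _≡_ _≡_ e × Image e ≐ P
enumerate {n} {P} P? =
  length is , lookup is ,
  lookup-injective (Unique.filter⁺ P? (Unique.allFin⁺ n)) ,
  (λ { (j , refl) → proj₂ (∈-filter⁻ P? {xs = allFin n} (∈-lookup j)) }) ,
  λ {i} Pi → let i∈is = ∈-filter⁺ P? (∈-allFin i) Pi in
    index i∈is , ≡.sym (lookup-index i∈is)
  where is = filter P? (allFin n)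

-- The intersection of two coordinate sets, enumerated by `e`. Only the images matter, since `e` is
-- used up to reordering of its domain.
record IsPullback {m} (e : Fin m → Fin n) (f : Fin k → Fin n)
                  (g : Fin l → Fin n) : Set where
  field
    injective : Injective _≡_ _≡_ e
    image     : Image e ≐ Image f ∩ Image g

pullback-swap : {e : Fin m → Fin n} {f : Fin k → Fin n} {g : Fin l → Fin n} →
                IsPullback e f g → IsPullback e g f
pullback-swap p = record
  { injective = p.injective
  ; image     = (λ x → proj₂ (p.image .proj₁ x) , proj₁ (p.image .proj₁ x)) ,
                (λ (y , z) → p.image .proj₂ (z , y))
  }
  where module p = IsPullback p

pullback : (f : Fin k → Fin n) (g : Fin l → Fin n) →
           ∃[ m ] ∃[ e ] IsPullback {m = m} e f g
pullback f g with enumerate (λ i → image? f i ×-dec image? g i)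
... | m , e , e-inj , img = m , e , record { injective = e-inj ; image = img }

record IsPartition (f : Fin k → Fin n) (g : Fin l → Fin n) : Set where
  field
    injectiveˡ : Injective _≡_ _≡_ f
    injectiveʳ : Injective _≡_ _≡_ g
    disjoint   : ∀ i j → f i ≢ g j
    cover      : ∀ i → Image f i ⊎ Image g i

permutation-injective : (σ : Permutation m n) → Injective _≡_ _≡_ (σ ⟨$⟩ʳ_)
permutation-injective σ {i} {j} eq =
  ≡.trans (≡.sym (inverseˡ σ)) (≡.trans (cong (σ ⟨$⟩ˡ_) eq) (inverseˡ σ))

↑-disjoint : ∀ {m n} (i : Fin m) (j : Fin n) → i ↑ˡ n ≢ m ↑ʳ j
↑-disjoint {m} {n} i j eq
  with () ← ≡.trans (≡.sym (splitAt-↑ˡ m i n))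
              (≡.trans (cong (splitAt m) eq) (splitAt-↑ʳ m n j))

↑-cover : ∀ m {n} (i : Fin (m + n)) → Image (_↑ˡ n) i ⊎ Image (m ↑ʳ_) i
↑-cover m {n} i with splitAt m i | join-splitAt m n i
... | inj₁ j | eq = inj₁ (j , eq)
... | inj₂ j | eq = inj₂ (j , eq)

permutation-partition : (σ : Permutation (k + l) n) →
  IsPartition (λ i → σ ⟨$⟩ʳ (i ↑ˡ l)) (λ j → σ ⟨$⟩ʳ (k ↑ʳ j))
permutation-partition {k} {l} {n} σ = record
  { injectiveˡ = ↑ˡ-injective l _ _ ∘ permutation-injective σ
  ; injectiveʳ = ↑ʳ-injective k _ _ ∘ permutation-injective σ
  ; disjoint   = λ i j → ↑-disjoint i j ∘ permutation-injective σ
  ; cover      = λ i → Sum.map (λ (j , eq) → j , at i eq) (λ (j , eq) → j , at i eq)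
                         (↑-cover k (σ ⟨$⟩ˡ i))
  }
  where
  at : ∀ i {j} → j ≡ σ ⟨$⟩ˡ i → σ ⟨$⟩ʳ j ≡ i
  at i eq = ≡.trans (cong (σ ⟨$⟩ʳ_) eq) (inverseʳ σ)

++-injective : {f : Fin k → Fin n} {g : Fin l → Fin n} →
               Injective _≡_ _≡_ f → Injective _≡_ _≡_ g →
               (∀ i j → f i ≢ g j) → Injective _≡_ _≡_ (f ++ g)
++-injective {k} {n} {l} {f} {g} f-inj g-inj f#g {i} {j} eq =
  ≡.trans (≡.sym (join-splitAt k l i))
    (≡.trans (cong (join k l) (split-inj (splitAt k i) (splitAt k j) eq))
      (join-splitAt k l j))
  where
  split-inj : ∀ s t → [ f , g ] s ≡ [ f , g ] t → s ≡ t
  split-inj (inj₁ i) (inj₁ j) eq = cong inj₁ (f-inj eq)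
  split-inj (inj₁ i) (inj₂ j) eq = ⊥-elim (f#g i j eq)
  split-inj (inj₂ i) (inj₁ j) eq = ⊥-elim (f#g j i (≡.sym eq))
  split-inj (inj₂ i) (inj₂ j) eq = cong inj₂ (g-inj eq)

++-image⁺ : (f : Fin k → Fin n) (g : Fin l → Fin n) →
            ∀ {i} → Image f i ⊎ Image g i → Image (f ++ g) i
++-image⁺ {k} {l = l} f g (inj₁ (j , refl)) =
  j ↑ˡ l , cong [ f , g ] (splitAt-↑ˡ k j l)
++-image⁺ {k} {l = l} f g (inj₂ (j , refl)) =
  k ↑ʳ j , cong [ f , g ] (splitAt-↑ʳ k l j)

++-all : ∀ {p} {f : Fin k → Fin n} {g : Fin l → Fin n} (P : Pred (Fin n) p) →
         (∀ i → P (f i)) → (∀ j → P (g j)) → ∀ i → P ((f ++ g) i)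
++-all {k} P Pf Pg i with splitAt k i
... | inj₁ j = Pf j
... | inj₂ j = Pg j

-- Projections of homogeneous sets and refinement.

module Restriction {α ℓ} (𝔸 : Setoid α ℓ) where
  open Setoid 𝔸 using (reflexive)
  open Words 𝔸
  open Homogeneous

  infix 8 _∣_
  -- This is the projection of `H` to the coordinates listed by `e`: every word is shortened and
  -- none is discarded.
  _∣_ : (H : Homogeneous) → (Fin k → Fin (dim H)) → Homogeneous
  _∣_ {k} H e = record
    { dim      = k
    ; words    = λ u → ∃[ w ] w ∈ words H × u ≋ w ∘ e
    ; resp     = λ u≋v (w , w∈H , u≋) → w , w∈H , ≋-trans (≋-sym u≋v) u≋
    ; nonempty = let w , w∈H = nonempty H in w ∘ e , w , w∈H , ≋-refl
    }

  -- Two injective enumerations of one coordinate set differ by a permutation, so the class of a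
  -- projection depends only on that set.
  ∣-sameImage : ∀ H {e : Fin k → Fin (dim H)} {f : Fin l → Fin (dim H)} →
                Injective _≡_ _≡_ e → Injective _≡_ _≡_ f →
                (∀ i → Image f (e i)) → (∀ j → Image e (f j)) →
                H ∣ e ∼ H ∣ f
  ∣-sameImage H {e} {f} e-inj f-inj to from
    -- The arguments are exchanged because `mk∼` takes a permutation from the target's coordinates
    -- to the source's.
    with π , eπ≡f ← sameImage⇒↔ f-inj e-inj from to =
    mk∼ (H ∣ e) (H ∣ f) π
      (λ (w , w∈H , u≋) → w , w∈H , λ i →
        Setoid.trans 𝔸 (u≋ _) (reflexive (cong w (eπ≡f i))))
      (λ (w , w∈H , u≋) → w , w∈H , λ i →
        Setoid.trans 𝔸 (u≋ _) (reflexive (cong w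
          (≡.trans (≡.sym (eπ≡f _)) (cong e (inverseʳ π))))))

  ∣-transport : ∀ {H K} ((σ , _) : H ∼ K) (e : Fin k → Fin (dim K)) →
                K ∣ e ∼ H ∣ (σ ⟨$⟩ʳ_) ∘ e
  ∣-transport {H = H} {K} H∼K@(σ , _) e =
    mk∼ (K ∣ e) (H ∣ (σ ⟨$⟩ʳ_) ∘ e) Perm.id
      (λ (w , w∈K , u≋) → _ , ∼-from {H} {K} H∼K w∈K , λ i →
        Setoid.trans 𝔸 (u≋ i) (reflexive (cong w (≡.sym (inverseˡ σ)))))
      (λ (w , w∈H , u≋) → _ , ∼-to {H} {K} H∼K w∈H , u≋)

  -- Nonemptiness of `K` is what extends each word of `H` to a word of the product.
  ⋆-∣ˡ : ∀ H K → H ∼ (H ⋆ K) ∣ (_↑ˡ dim K)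
  ⋆-∣ˡ H K = mk∼ H ((H ⋆ K) ∣ (_↑ˡ dim K)) Perm.id
    (λ {u} u∈H → let v , v∈K = nonempty K in
      u ++ v , (u , v , u∈H , v∈K , ≋-refl) , ≋-sym (++-↑ˡ u v))
    (λ (w , w∈ , u≋) → resp H (≋-sym u≋) (⊛⁻ˡ (resp H) w∈))

  ⋆-∣ʳ : ∀ H K → K ∼ (H ⋆ K) ∣ (dim H ↑ʳ_)
  ⋆-∣ʳ H K = mk∼ K ((H ⋆ K) ∣ (dim H ↑ʳ_)) Perm.id
    (λ {v} v∈K → let u , u∈H = nonempty H in
      u ++ v , (u , v , u∈H , v∈K , ≋-refl) , ≋-sym (++-↑ʳ u v))
    (λ (w , w∈ , v≋) → resp K (≋-sym v≋) (⊛⁻ʳ (resp K) w∈))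

  -- A splicing property: for complementary `e` and `f` it says that `H` is, up to reordering, the
  -- product of its two projections, without mentioning those projections.
  Independent : (H : Homogeneous) → (Fin k → Fin (dim H)) →
                (Fin l → Fin (dim H)) → Set _
  Independent H e f = ∀ {w w′} → w ∈ words H → w′ ∈ words H →
    ∃[ w″ ] w″ ∈ words H × w″ ∘ e ≋ w ∘ e × w″ ∘ f ≋ w′ ∘ f

  ⋆-independent : ∀ {H K L} ((σ , _) : H ∼ K ⋆ L) →
    Independent H (λ i → σ ⟨$⟩ʳ (i ↑ˡ dim L)) (λ j → σ ⟨$⟩ʳ (dim K ↑ʳ j))
  ⋆-independent {H} {K} {L} e@(σ , _) {w} {w′} w∈H w′∈H =
    w″ ∘ (σ ⟨$⟩ˡ_) , ∼-from {H} {K ⋆ L} e w″∈ ,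
    (λ i → Setoid.trans 𝔸 (reflexive (cong w″ (inverseˡ σ))) (++-↑ˡ u v i)) ,
    (λ j → Setoid.trans 𝔸 (reflexive (cong w″ (inverseˡ σ))) (++-↑ʳ u v j))
    where
    u = λ i → w (σ ⟨$⟩ʳ (i ↑ˡ dim L))
    v = λ j → w′ (σ ⟨$⟩ʳ (dim K ↑ʳ j))
    w″ = u ++ v
    w″∈ : w″ ∈ words (K ⋆ L)
    w″∈ = u , v , ⊛⁻ˡ (resp K) (∼-to {H} {K ⋆ L} e w∈H)
                , ⊛⁻ʳ (resp L) (∼-to {H} {K ⋆ L} e w′∈H) , ≋-refl

  -- Independence is inherited by smaller groups of coordinates: the word spliced along `e′` and
  -- `f′` also has the prescribed values along `e` and `f`. This freedom lets a decomposition of `H`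
  -- act on a projection of `H`.
  ∣-++ : ∀ H {e : Fin k → Fin (dim H)} {f : Fin l → Fin (dim H)}
           {k′ l′} {e′ : Fin k′ → Fin (dim H)} {f′ : Fin l′ → Fin (dim H)} →
         Independent H e′ f′ → Image e ⊆ Image e′ → Image f ⊆ Image f′ →
         H ∣ (e ++ f) ∼ H ∣ e ⋆ H ∣ f
  ∣-++ {k} {l} H {e} {f} {e′ = e′} {f′} ind e⊆e′ f⊆f′ =
    mk∼ (H ∣ (e ++ f)) (H ∣ e ⋆ H ∣ f) Perm.id
      (λ {u} (w , w∈H , u≋) →
        w ∘ e , w ∘ f , (w , w∈H , ≋-refl) , (w , w∈H , ≋-refl) ,
        ≋-trans u≋ (distrib w))
      (λ (x , y , (w , w∈H , x≋) , (w′ , w′∈H , y≋) , u≋) →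
        let w″ , w″∈H , e′≋ , f′≋ = ind w∈H w′∈H in
        w″ , w″∈H , ≋-trans u≋
          (≋-trans (++⁺ (Setoid._≈_ 𝔸)
                      (≋-trans x≋ (≋-sym (along w″ w e⊆e′ e′≋)))
                      (≋-trans y≋ (≋-sym (along w″ w′ f⊆f′ f′≋))))
                   (≋-sym (distrib w″))))
    where
    distrib : ∀ w → w ∘ (e ++ f) ≋ (w ∘ e) ++ (w ∘ f)
    distrib w i with splitAt k i
    ... | inj₁ _ = Setoid.refl 𝔸
    ... | inj₂ _ = Setoid.refl 𝔸
    along : ∀ {p q} {g : Fin p → Fin (dim H)} {h : Fin q → Fin (dim H)}
            (w w′ : Word (dim H)) →
            Image g ⊆ Image h → w ∘ h ≋ w′ ∘ h → w ∘ g ≋ w′ ∘ g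
    along w w′ g⊆h w≋w′ i with j , eq ← g⊆h (i , refl) =
      ≡.subst (λ x → Setoid._≈_ 𝔸 (w x) (w′ x)) eq (w≋w′ j)

  -- As `g` and `h` partition all coordinates, `r ++ s` is another enumeration of those of `f`; the
  -- decomposition of `H` along `g` and `h` then separates the two pieces.
  ∣-split : ∀ H {f : Fin m → Fin (dim H)}
              {g : Fin k → Fin (dim H)} {h : Fin l → Fin (dim H)}
              {p q} {r : Fin p → Fin (dim H)} {s : Fin q → Fin (dim H)} →
            Injective _≡_ _≡_ f → IsPartition g h → Independent H g h →
            IsPullback r f g → IsPullback s f h →
            H ∣ f ∼ H ∣ r ⋆ H ∣ s
  ∣-split H {f} {g} {h} {r = r} {s} f-inj g⊎h ind f∩g f∩h =
    ∼-trans {H ∣ f} {H ∣ (r ++ s)} {H ∣ r ⋆ H ∣ s}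
      (∣-sameImage H f-inj
        (++-injective r.injective s.injective r#s)
        (λ i → ++-image⁺ r s (Sum.map (λ i∈g → r.image .proj₂ ((i , refl) , i∈g))
                                      (λ i∈h → s.image .proj₂ ((i , refl) , i∈h))
                                      (cover (f i))))
        (++-all (Image f) (λ i → proj₁ (r.image .proj₁ (i , refl)))
                          (λ j → proj₁ (s.image .proj₁ (j , refl)))))
      (∣-++ H ind (proj₂ ∘ r.image .proj₁) (proj₂ ∘ s.image .proj₁))
    where
    module r = IsPullback f∩g
    module s = IsPullback f∩h
    open IsPartition g⊎h
    r#s : ∀ i j → r i ≢ s j
    r#s i j eq
      with i′ , gi′≡ ← proj₂ (r.image .proj₁ (i , refl))
      with j′ , hj′≡ ← proj₂ (s.image .proj₁ (j , refl)) =
      disjoint i′ j′ (≡.trans gi′≡ (≡.trans eq (≡.sym hj′≡)))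

  -- All four factors are read off as coordinate groups `a`, `b`, `c`, `d` of the single set
  -- `H = A ⋆ B`, the last two transported by `σ`. The table consists of the projections to their
  -- pairwise intersections; `A` and `B` split along `c` and `d`, while `C` and `D` split along `a`
  -- and `b`.
  ⋆-refinement : Refinement homogeneousMonoid
  ⋆-refinement {A} {B} {C} {D} H∼C⋆D@(σ , _)
    with _ , r , ac ← pullback (_↑ˡ dim B) (λ i → σ ⟨$⟩ʳ (i ↑ˡ dim D))
       | _ , s , ad ← pullback (_↑ˡ dim B) (λ j → σ ⟨$⟩ʳ (dim C ↑ʳ j))
       | _ , t , bc ← pullback (dim A ↑ʳ_) (λ i → σ ⟨$⟩ʳ (i ↑ˡ dim D))
       | _ , u , bd ← pullback (dim A ↑ʳ_) (λ j → σ ⟨$⟩ʳ (dim C ↑ʳ j)) =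
    H ∣ r , H ∣ s , H ∣ t , H ∣ u ,
    ∼-trans {A} {H ∣ a} {H ∣ r ⋆ H ∣ s} (⋆-∣ˡ A B)
      (∣-split H ab.injectiveˡ c⊎d c⊥d ac ad) ,
    ∼-trans {B} {H ∣ b} {H ∣ t ⋆ H ∣ u} (⋆-∣ʳ A B)
      (∣-split H ab.injectiveʳ c⊎d c⊥d bc bd) ,
    ∼-trans {C} {H ∣ c} {H ∣ r ⋆ H ∣ t}
      (∼-trans {C} {(C ⋆ D) ∣ (_↑ˡ dim D)} {H ∣ c}
        (⋆-∣ˡ C D) (∣-transport {H = H} {C ⋆ D} H∼C⋆D _))
      (∣-split H cd.injectiveˡ a⊎b a⊥b (pullback-swap ac) (pullback-swap bc)) ,
    ∼-trans {D} {H ∣ d} {H ∣ s ⋆ H ∣ u}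
      (∼-trans {D} {(C ⋆ D) ∣ (dim C ↑ʳ_)} {H ∣ d}
        (⋆-∣ʳ C D) (∣-transport {H = H} {C ⋆ D} H∼C⋆D _))
      (∣-split H cd.injectiveʳ a⊎b a⊥b (pullback-swap ad) (pullback-swap bd))
    where
    H = A ⋆ B
    a = _↑ˡ dim B
    b = dim A ↑ʳ_
    c = λ i → σ ⟨$⟩ʳ (i ↑ˡ dim D)
    d = λ j → σ ⟨$⟩ʳ (dim C ↑ʳ j)
    a⊎b : IsPartition a b
    a⊎b = permutation-partition Perm.id
    c⊎d : IsPartition c d
    c⊎d = permutation-partition σ
    module ab = IsPartition a⊎b
    module cd = IsPartition c⊎d
    a⊥b : Independent H a b
    a⊥b = ⋆-independent {H} {A} {B} (∼-refl {H})
    c⊥d : Independent H c d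
    c⊥d = ⋆-independent {H} {C} {D} H∼C⋆D

-- Factors of cubical areas.

open Wℝ using (_∼_; _⋆_)
open Wℝ.Homogeneous using (dim)
module Rℝ = Restriction Real.setoid
module R𝓘 = Restriction intervalSetoid

-- Coordinates outside the image of `e` are filled with a point of the corresponding interval, which
-- exists because intervals are nonempty.
extend : ∀ {k n} {e : Fin k → Fin n} → Injective _≡_ _≡_ e →
         ∀ (C : Cube n) {x} → x ∈ ⟦ C ∘ e ⟧ →
         ∃[ w ] w ∈ ⟦ C ⟧ × x Wℝ.≋ w ∘ e
extend {e = e} e-inj C {x} x∈ =
  proj₁ ∘ at , proj₁ ∘ proj₂ ∘ at , λ j → proj₂ (proj₂ (at (e j))) j refl
  where
  -- The value comes with its agreement for every `j` over `i`, so the case split need not be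
  -- reopened at `i = e j`.
  at : ∀ i → ∃[ r ] r ∈ Interval.contains (C i) ×
                    (∀ j → e j ≡ i → x j Real.≈ r)
  at i with image? e i
  ... | yes (j , refl) = x j , x∈ j , λ j′ eq →
    Setoid.reflexive Real.setoid (cong x (e-inj eq))
  ... | no i∉e =
    let r , r∈ = Interval.nonempty (C i)
    in r , r∈ , λ j eq → ⊥-elim (i∉e (j , eq))

-- The projection of a cube is the cube of the selected intervals, and projection commutes with
-- unions.
γ-∣ : ∀ F {k} {e : Fin k → Fin (W𝓘.Homogeneous.dim F)} →
      Injective _≡_ _≡_ e → γ (F R𝓘.∣ e) ∼ γ F Rℝ.∣ e
γ-∣ F {e = e} e-inj = Wℝ.mk∼ (γ (F R𝓘.∣ e)) (γ F Rℝ.∣ e) Perm.id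
  (λ {x} (D , (C , C∈F , D≋) , x∈D) →
    let w , w∈C , x≋ = extend e-inj C {x} (λ j → D≋ j .proj₁ (x∈D j))
    in w , (C , C∈F , w∈C) , x≋)
  (λ {x} (w , (C , C∈F , w∈C) , x≋) →
    C ∘ e , (C , C∈F , W𝓘.≋-refl {x = C ∘ e}) ,
    λ j → contains-resp (C (e j)) {w (e j)} {x j}
            (Setoid.sym Real.setoid {x j} {w (e j)} (x≋ j)) (w∈C (e j)))

finite-∣ : ∀ F {k} (e : Fin k → Fin (W𝓘.Homogeneous.dim F)) →
           W𝓘.FinitelyMany F → W𝓘.FinitelyMany (F R𝓘.∣ e)
finite-∣ F {k} e (Cs , F⇔) = map (_∘ e) Cs , λ D → mk⇔
  (λ (C , C∈F , D≋) →
    Membershipₚ.∈-resp-≈ (S k) {x = C ∘ e} {D} (Setoid.sym (S k) {D} {C ∘ e} D≋)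
      (Membershipₚ.∈-map⁺ (S d) (S k) {_∘ e} (λ C≋ i → C≋ (e i)) {C}
        (Equivalence.to (F⇔ C) C∈F)))
  (λ D∈ → let C , C∈ , D≋ = Membershipₚ.∈-map⁻ (S d) (S k) {D} {Cs} {_∘ e} D∈ in
    C , Equivalence.from (F⇔ C) C∈ , D≋)
  where
  S = W𝓘.≋-setoid
  d = W𝓘.Homogeneous.dim F

area-resp : ∀ {H K} → H ∼ K → IsCubicalArea H → IsCubicalArea K
area-resp {H} {K} H∼K (F , fin , γF∼H) =
  F , fin , Wℝ.∼-trans {γ F} {H} {K} γF∼H H∼K

-- The covering `F` may order its coordinates differently from `H`, hence it is restricted along `e`
-- followed by `σ`.
area-∣ : ∀ H {k} {e : Fin k → Fin (dim H)} → Injective _≡_ _≡_ e →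
         IsCubicalArea H → IsCubicalArea (H Rℝ.∣ e)
area-∣ H {e = e} e-inj (F , fin , γF∼H@(σ , _)) =
  F R𝓘.∣ σe , finite-∣ F σe fin ,
  Wℝ.∼-trans {γ (F R𝓘.∣ σe)} {γ F Rℝ.∣ σe} {H Rℝ.∣ e}
    (γ-∣ F (e-inj ∘ permutation-injective σ))
    (Wℝ.∼-sym {H Rℝ.∣ e} {γ F Rℝ.∣ σe} (Rℝ.∣-transport {H = γ F} {H} γF∼H e))
  where σe = (σ ⟨$⟩ʳ_) ∘ e

-- This brings the refinement found among all homogeneous sets back into `Are`: a factor is a
-- projection of the product.
area-factorˡ : ∀ {A} H K → A ∼ H ⋆ K → IsCubicalArea A → IsCubicalArea H
area-factorˡ {A} H K A∼ area = area-resp {(H ⋆ K) Rℝ.∣ left} {H}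
  (Wℝ.∼-sym {H} {(H ⋆ K) Rℝ.∣ left} (Rℝ.⋆-∣ˡ H K))
  (area-∣ (H ⋆ K) (↑ˡ-injective (dim K) _ _) (area-resp {A} {H ⋆ K} A∼ area))
  where left = _↑ˡ dim K

area-factorʳ : ∀ {A} H K → A ∼ H ⋆ K → IsCubicalArea A → IsCubicalArea K
area-factorʳ {A} H K A∼ =
  area-factorˡ {A} K H (Wℝ.∼-trans {A} {H ⋆ K} {K ⋆ H} A∼ (Wℝ.⋆-comm H K))

Are-refinement : Refinement Are
Are-refinement {a , a∈} {b , b∈} {c , c∈} {d , d∈} ab∼cd =
  let r , s , t , u , a∼rs , b∼tu , c∼rt , d∼su =
        Rℝ.⋆-refinement {a} {b} {c} {d} ab∼cd
  in (r , area-factorˡ {a} r s a∼rs a∈) , (s , area-factorʳ {a} r s a∼rs a∈) ,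
     (t , area-factorˡ {b} t u b∼tu b∈) , (u , area-factorʳ {b} t u b∼tu b∈) ,
     a∼rs , b∼tu , c∼rt , d∼su

Are-size : Size Are
Are-size = record
  { size      = dim ∘ proj₁
  ; size-cong = λ (σ , _) → ≡.sym (Perm.↔⇒≡ σ)
  ; size-∙    = λ _ _ → refl
  ; size≡0⇒≈ε = λ {(H , _)} → dim≡0⇒∼unit H
  }
  where
  dim≡0⇒∼unit : ∀ H → dim H ≡ 0 → H ∼ Wℝ.unit
  dim≡0⇒∼unit H eq = Wℝ.mk∼ H Wℝ.unit (Perm.cast-id (≡.sym eq)) _
    -- In dimension 0 any two words are equal, so the word given by `nonempty` yields every word.
    (λ _ → Wℝ.Homogeneous.resp H
      (λ i → ⊥-elim (¬Fin0 (≡.subst Fin eq i))) (proj₂ (Wℝ.Homogeneous.nonempty H)))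

-- Infinitely many one-point areas.

fromℚ : ℚ → ℝ
fromℚ q = record
  { L         = ℚ._< q
  ; U         = q ℚ.<_
  ; L-inhab   = q ℚ.- ℚ.1ℚ ,
                ≡.subst (q ℚ.- ℚ.1ℚ ℚ.<_) (ℚ.+-identityʳ q)
                  (ℚ.+-monoʳ-< q {ℚ.- ℚ.1ℚ} {ℚ.0ℚ} (ℚ.*<* ℤ.-<+))
  ; U-inhab   = q ℚ.+ ℚ.1ℚ ,
                ≡.subst (ℚ._< q ℚ.+ ℚ.1ℚ) (ℚ.+-identityʳ q)
                  (ℚ.+-monoʳ-< q {ℚ.0ℚ} {ℚ.1ℚ} (ℚ.*<* (ℤ.+<+ (s≤s z≤n))))
  ; L-rounded = λ p → mk⇔ ℚ.<-dense (λ (r , p<r , r<q) → ℚ.<-trans p<r r<q)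
  ; U-rounded = λ p → mk⇔
      (λ q<p → let r , q<r , r<p = ℚ.<-dense q<p in r , r<p , q<r)
      (λ (r , r<p , q<r) → ℚ.<-trans q<r r<p)
  ; disjoint  = λ p (p<q , q<p) → ℚ.<-asym p<q q<p
  ; located   = located
  }
  where
  located : ∀ p r → p ℚ.< r → p ℚ.< q ⊎ q ℚ.< r
  located p r p<r with ℚ.<-cmp p q
  ... | tri< p<q _ _  = inj₁ p<q
  ... | tri≈ _ refl _ = inj₂ p<r
  ... | tri> _ _ q<p  = inj₂ (ℚ.<-trans q<p p<r)

-- If `p` were smaller than `q`, it would lie in the lower cut of `q` but not in its own; the other
-- case is symmetric.
fromℚ-injective : ∀ {p q} → fromℚ p Real.≈ fromℚ q → p ≡ q
fromℚ-injective {p} {q} (p≤q , q≤p) with ℚ.<-cmp p q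
... | tri< p<q _ _ = ⊥-elim (ℚ.<-irrefl refl (q≤p p<q))
... | tri≈ _ p≡q _ = p≡q
... | tri> _ _ q<p = ⊥-elim (ℚ.<-irrefl refl (p≤q q<p))

-- The `0` is the denominator minus one. Using the constructor directly makes injectivity a matter
-- of pattern matching.
fromℕ : ℕ → ℚ
fromℕ n = mkℚ (ℤ.+ n) 0 (Coprime.sym (Coprime.1-coprimeTo n))

fromℕ-injective : ∀ {m n} → fromℕ m ≡ fromℕ n → m ≡ n
fromℕ-injective refl = refl

point : ℝ → Interval
point x = record
  { lower = including x ; upper = including x ; nonempty = x , id , id }

pointCovering : ℝ → CubicalCovering
pointCovering x = record
  { dim      = 1
  ; words    = λ C → C W𝓘.≋ λ _ → point x
  ; resp     = λ {C} {D} C≋D C≋x → W𝓘.≋-trans {_} {D} {C} {λ _ → point x}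
                 (W𝓘.≋-sym {_} {C} {D} C≋D) C≋x
  ; nonempty = (λ _ → point x) , W𝓘.≋-refl {x = λ _ → point x}
  }

pointArea : ℝ → CommutativeMonoid.Carrier Are
pointArea x = γ F , F , finite , Wℝ.∼-refl {γ F}
  where
  F = pointCovering x
  finite : W𝓘.FinitelyMany F
  finite = (λ _ → point x) ∷ [] , λ C → mk⇔ here λ { (here C≋x) → C≋x ; (there ()) }

-- The constant word at `x` is unchanged by any permutation of coordinates, so it lies in a cube
-- equal to the point `y`; the two endpoint conditions give both inequalities.
pointArea-injective : ∀ {x y} →
  CommutativeMonoid._≈_ Are (pointArea x) (pointArea y) → x Real.≈ y
pointArea-injective {x} {y} x∼y@(σ , _) =
  let C , C≋y , x∈C = Wℝ.∼-to {γ (pointCovering x)} {γ (pointCovering y)} x∼y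
        {λ _ → x} ((λ _ → point x) , W𝓘.≋-refl {x = λ _ → point x} , λ _ → id , id)
      y≤x , x≤y = C≋y zero .proj₁ (x∈C zero)
  in x≤y , y≤x

theorem2 : (∀ {ℓ} → ExcludedMiddle ℓ) → IsFree Are × InfinitelyManyIrreducibles Are
theorem2 em =
  isFree Are Are-size em (λ {a} {b} {c} {d} → Are-refinement {a} {b} {c} {d}) ,
  (λ n → pointArea (fromℚ (fromℕ n))) ,
  (λ n → size≡1⇒irreducible Are Are-size {pointArea (fromℚ (fromℕ n))} refl) ,
  λ {m} {n} x∼y → fromℕ-injective (fromℚ-injective
    (pointArea-injective {fromℚ (fromℕ m)} {fromℚ (fromℕ n)} x∼y))
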